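{- Let $\mathcal{H}=(V,E)$ be a finite hypergraph in which every hyperedge has size at least $2$. Let $\mathcal{H}^{[1]}$ denote its $1$-intersection graph. If $\chi(\mathcal{H}^{[1]})=4$, then $\chi(\mathcal{H})\le 4$.
   Context: A hypergraph $\mathcal{H}=(V,E)$ consists of a finite vertex set $V$ and a collection $E$ of subsets of $V$ (hyperedges). A vertex coloring of $\mathcal{H}$ is proper if no hyperedge is monochromatic; $\chi(\mathcal{H})$ is the least number of colors in a proper vertex coloring of $\mathcal{H}$ (which exists since all hyperedges have size at least $2$). The $1$-intersection graph $\mathcal{H}^{[1]}$ of $\mathcal{H}$ is the graph whose vertex set is $E(\mathcal{H})$, in which two distinct hyperedges $e,f$ are adjacent if and only if $|e\cap f|=1$. $\chi(\mathcal{H}^{[1]})$ is the usual chromatic number of this graph. -}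

module Defs where

open import Data.Fin using (Fin; zero; suc; finToFun; funToFin)
open import Data.Fin.Properties using (any?; all?; finToFun-funToFin) renaming (_≟_ to _≟ᶠ_)
open import Data.Fin.Subset using (Subset; _∈_; _∩_; ∣_∣; ⁅_⁆)
open import Data.Fin.Subset.Properties
  using (_∈?_; nonempty?; Empty-unique; ∣⊥∣≡0; ∣⁅x⁆∣≡1; x∈⁅x⁆; p⊆q⇒∣p∣≤∣q∣; ∩-comm)
open import Data.Nat using (ℕ; zero; suc; _≤_; z≤n; s≤s)
import Data.Nat.Properties as ℕ
open import Data.Product using (∃; _×_; _,_; proj₁)
open import Function.Base using (id; _∘_)
open import Function.Definitions using (Injective)
open import Relation.Binary.Definitions using (Decidable; Symmetric; Irreflexive)
open import Relation.Binary.PropositionalEquality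
  using (_≡_; _≢_; _≗_; refl; sym; trans; cong; subst)
open import Relation.Nullary using (¬_; Dec; yes; no; contradiction)
open import Relation.Nullary.Decidable using (map′; ¬?; _×-dec_; _→-dec_)
import Relation.Unary as U

------------------------------------------------------------------------
-- Graphs and hypergraphs

-- Finite simple graphs; adjacency is decidable so that the chromatic
-- number can be computed.
record Graph : Set₁ where
  field
    order  : ℕ
    Adj    : Fin order → Fin order → Set
    adj?   : Decidable Adj
    symm   : Symmetric Adj
    irrefl : Irreflexive _≡_ Adj

-- The hyperedges form a set, not a multiset: they are listed without
-- repetition as edge 0, …, edge (size − 1).
record Hypergraph : Set where
  field
    order    : ℕ
    size     : ℕ
    edge     : Fin size → Subset order
    edge-inj : Injective _≡_ _≡_ edge

EdgesOfSize≥2 : Hypergraph → Set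
EdgesOfSize≥2 H = ∀ i → 2 ≤ ∣ edge i ∣
  where open Hypergraph H

-- By edge-inj, distinct indices are the same thing as distinct hyperedges.
_^[1] : Hypergraph → Graph
H ^[1] = record
  { order  = size
  ; Adj    = λ i j → i ≢ j × ∣ edge i ∩ edge j ∣ ≡ 1
  ; adj?   = λ i j → ¬? (i ≟ᶠ j) ×-dec (∣ edge i ∩ edge j ∣ ℕ.≟ 1)
  ; symm   = λ {i} {j} (i≢j , eq) →
               (i≢j ∘ sym) , trans (cong ∣_∣ (∩-comm (edge j) (edge i))) eq
  ; irrefl = λ i≡j (i≢j , _) → i≢j i≡j
  }
  where open Hypergraph H

------------------------------------------------------------------------
-- Proper colorings

Coloring : ℕ → ℕ → Set
Coloring n k = Fin n → Fin k

ProperG : ∀ (G : Graph) {k} → Coloring (Graph.order G) k → Set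
ProperG G c = ∀ u v → Adj u v → c u ≢ c v
  where open Graph G

Monochromatic : ∀ {n k} → Coloring n k → Subset n → Set
Monochromatic c e = ∀ x y → x ∈ e → y ∈ e → c x ≡ c y

ProperH : ∀ (H : Hypergraph) {k} → Coloring (Hypergraph.order H) k → Set
ProperH H c = ∀ i → ¬ Monochromatic c (edge i)
  where open Hypergraph H

ColorableG : Graph → ℕ → Set
ColorableG G k = ∃ λ (c : Coloring (Graph.order G) k) → ProperG G c

ColorableH : Hypergraph → ℕ → Set
ColorableH H k = ∃ λ (c : Coloring (Hypergraph.order H) k) → ProperH H c

------------------------------------------------------------------------
-- Colorability is decidable

∃-coloring? : ∀ {n k} {P : Coloring n k → Set} →
              (∀ {c d} → c ≗ d → P c → P d) → U.Decidable P → Dec (∃ P)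
∃-coloring? resp P? = map′
  (λ (i , p) → finToFun i , p)
  (λ (c , p) → funToFin c , resp (λ x → sym (finToFun-funToFin c x)) p)
  (any? (λ i → P? (finToFun i)))

colorableG? : ∀ G → U.Decidable (ColorableG G)
colorableG? G k = ∃-coloring?
  (λ eq p u v a e → p u v a (trans (eq u) (trans e (sym (eq v)))))
  (λ c → all? λ u → all? λ v → adj? u v →-dec ¬? (c u ≟ᶠ c v))
  where open Graph G

colorableH? : ∀ H → U.Decidable (ColorableH H)
colorableH? H k = ∃-coloring?
  (λ eq p i m → p i λ x y x∈ y∈ → trans (eq x) (trans (m x y x∈ y∈) (sym (eq y))))
  (λ c → all? λ i → ¬? (all? λ x → all? λ y →
     (x ∈? edge i) →-dec ((y ∈? edge i) →-dec (c x ≟ᶠ c y))))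
  where open Hypergraph H

------------------------------------------------------------------------
-- Chromatic numbers

IsLeast : (ℕ → Set) → ℕ → Set
IsLeast P k = P k × (∀ j → P j → k ≤ j)

least : ∀ {P : ℕ → Set} → U.Decidable P → ∀ m → P m → ∃ (IsLeast P)
least P? zero    p = zero , p , λ _ _ → z≤n
least {P} P? (suc m) p with P? zero
... | yes p₀ = zero , p₀ , λ _ _ → z≤n
... | no ¬p₀ with least {λ k → P (suc k)} (λ k → P? (suc k)) m p
...   | k , pk , lb = suc k , pk , λ where
          zero    pj → contradiction pj ¬p₀
          (suc j) pj → s≤s (lb j pj)

order-colorableG : ∀ G → ColorableG G (Graph.order G)
order-colorableG G = id , λ u v a u≡v → Graph.irrefl G u≡v a

subsingleton⇒∣p∣≤1 : ∀ {n} (p : Subset n) → Monochromatic id p → ∣ p ∣ ≤ 1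
subsingleton⇒∣p∣≤1 {n} p m with nonempty? p
... | yes (x , x∈p) = subst (∣ p ∣ ≤_) (∣⁅x⁆∣≡1 x)
        (p⊆q⇒∣p∣≤∣q∣ λ {y} y∈p → subst (_∈ ⁅ x ⁆) (m x y x∈p y∈p) (x∈⁅x⁆ x))
... | no empty rewrite Empty-unique empty | ∣⊥∣≡0 n = z≤n

order-colorableH : ∀ H → EdgesOfSize≥2 H → ColorableH H (Hypergraph.order H)
order-colorableH H h =
  id , λ i m → ℕ.<⇒≱ (h i) (subsingleton⇒∣p∣≤1 (Hypergraph.edge H i) m)

chromaticNumberG : ∀ G → ∃ (IsLeast (ColorableG G))
chromaticNumberG G = least (colorableG? G) _ (order-colorableG G)

chromaticNumberH : ∀ H → EdgesOfSize≥2 H → ∃ (IsLeast (ColorableH H))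
chromaticNumberH H h = least (colorableH? H) _ (order-colorableH H h)

χG : Graph → ℕ
χG G = proj₁ (chromaticNumberG G)

-- The size hypothesis guarantees that a proper coloring exists at all.
χH : ∀ H → EdgesOfSize≥2 H → ℕ
χH H h = proj₁ (chromaticNumberH H h)

{-# OPTIONS --safe #-}

-- Pair up the colour classes of H^[1].  The edges in two classes span a
-- subhypergraph whose 1-intersection graph is bipartite; each such hypergraph
-- is 2-colourable, and the product of the two 2-colourings is a proper
-- 4-colouring of H.
--
-- For the bipartite case, add the edges one at a time.  After adding an edge
-- there is a 2-colouring c and, for each class, a colour which every edge of
-- the class attains, the two colours being different.  While some edge e is
-- monochromatic, flip a vertex x ∈ e not flipped before: x exists because not
-- all of e had the opposite colour under c.  The flip preserves the invariant:
-- an edge of the same class through x shares a second vertex with e.  So at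
-- most |V| flips are made.

module Submission where

open import Defs
open import Data.Bool.Base using (Bool; true; false; not)
open import Data.Bool.Properties using (not-injective; not-involutive; not-¬; ¬-not)
  renaming (_≟_ to _≟ᵇ_)
open import Data.Fin.Base using (Fin; zero; suc)
open import Data.Fin.Properties using (any?; all?; ¬∀⟶∃¬; 2↔Bool; *↔×) renaming (_≟_ to _≟ᶠ_)
open import Data.Fin.Subset using (Subset; _∈_; _∩_; _⊂_; _-_; ∣_∣; Nonempty; ⊤)
open import Data.Fin.Subset.Induction using (Acc; acc; ⊂-wellFounded)
open import Data.Fin.Subset.Properties
  using (_∈?_; nonempty?; Empty-unique; ∣⊥∣≡0; ∈⊤; ∩-idem; x∈p∩q⁺; x∈p∩q⁻;
         x∈p⇒∣p-x∣<∣p∣; x∈p⇒p-x⊂p; x∈p∧x≢y⇒x∈p-y)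
open import Data.List.Base using (allFin; filter; lookup)
open import Data.List.Membership.Propositional.Properties
  using (∈-allFin; ∈-filter⁺; ∈-filter⁻; ∈-lookup)
open import Data.List.Relation.Unary.Any using (index)
open import Data.List.Relation.Unary.Any.Properties using (lookup-index)
open import Data.Nat using (ℕ; _≤_)
open import Data.Nat.Properties using (≤-antisym; m<n⇒0<n; <⇒≢)
open import Data.Product using (∃; _×_; _,_; proj₁; proj₂)
open import Data.Product.Function.NonDependent.Propositional using (_×-↔_)
open import Data.Vec.Functional using (updateAt)
open import Data.Vec.Functional.Properties using (updateAt-updates; updateAt-minimal)
open import Function.Base using (_∘_)
open import Function.Bundles using (_↔_; Inverse; Injection)
open import Function.Construct.Composition using (_↔-∘_)
open import Function.Properties.Inverse using (Inverse⇒Injection)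
open import Relation.Binary.PropositionalEquality
  using (_≡_; _≢_; refl; sym; trans; cong; cong₂; subst)
open import Relation.Nullary using (Dec; yes; no; contradiction)
open import Relation.Nullary.Decidable using (¬?; _×-dec_)

private
  variable
    n m : ℕ

2≤∣p∣⇒Nonempty : (p : Subset n) → 2 ≤ ∣ p ∣ → Nonempty p
2≤∣p∣⇒Nonempty {n} p 2≤∣p∣ with nonempty? p
... | yes nonempty = nonempty
... | no empty with refl ← Empty-unique empty =
  contradiction (sym (∣⊥∣≡0 n)) (<⇒≢ (m<n⇒0<n 2≤∣p∣))

-- Applied to the intersection of two edges of one class, this yields a second common vertex.
∣p∣≢1⇒∃-other : ∀ {p : Subset n} {x} → x ∈ p → ∣ p ∣ ≢ 1 → ∃ λ y → y ∈ p × y ≢ x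
∣p∣≢1⇒∃-other {p = p} {x} x∈p ∣p∣≢1
  with any? (λ y → (y ∈? p) ×-dec ¬? (y ≟ᶠ x))
... | yes other = other
... | no ¬other = contradiction
  (≤-antisym (subsingleton⇒∣p∣≤1 p λ y z y∈p z∈p → trans (≡x y y∈p) (sym (≡x z z∈p)))
             (m<n⇒0<n (x∈p⇒∣p-x∣<∣p∣ x∈p)))
  ∣p∣≢1
  where
  ≡x : ∀ y → y ∈ p → y ≡ x
  ≡x y y∈p with y ≟ᶠ x
  ... | yes y≡x = y≡x
  ... | no y≢x = contradiction (y , y∈p , y≢x) ¬other

Attains : (Fin n → Bool) → Bool → Subset n → Set
Attains c b p = ∃ λ x → x ∈ p × c x ≡ b

attains? : ∀ (c : Fin n → Bool) b p → Dec (Attains c b p)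
attains? c b p = any? λ x → (x ∈? p) ×-dec (c x ≟ᵇ b)

Bichromatic : (Fin n → Bool) → Subset n → Set
Bichromatic c p = ∀ b → Attains c b p

attains-both : ∀ {c : Fin n → Bool} b {p} → Attains c b p → Attains c (not b) p → Bichromatic c p
attains-both false at-b at-¬b false = at-b
attains-both false at-b at-¬b true  = at-¬b
attains-both true  at-b at-¬b false = at-¬b
attains-both true  at-b at-¬b true  = at-b

-- `β i` is at once the class of edge `i` and the colour it must keep attaining. The case `i = j` of
-- `same-class` excludes singleton edges.
module _ (E : Fin m → Subset n) (β : Fin m → Bool)
         (same-class : ∀ i j → β i ≡ β j → ∣ E i ∩ E j ∣ ≢ 1)
         (c : Fin n → Bool) (c-attains : ∀ i → Attains c (β i) (E i)) where

  -- U contains the vertices that have not been flipped yet.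
  flip-until-bichromatic :
    (d : Fin n → Bool) → (∀ i → Attains d (β i) (E i)) →
    (U : Subset n) → (∀ x → d x ≡ c x → x ∈ U) → Acc _⊂_ U →
    ∃ λ c′ → ∀ i → Bichromatic c′ (E i)
  flip-until-bichromatic d d-attains U unflipped (acc rec)
    with all? (λ i → attains? d (not (β i)) (E i))
  ... | yes d-attains¬ = d , λ i → attains-both (β i) (d-attains i) (d-attains¬ i)
  ... | no ¬d-attains¬
    with i , mono ← ¬∀⟶∃¬ _ _ (λ i → attains? d (not (β i)) (E i)) ¬d-attains¬
    -- The witness is taken from `c`: since `d` is constantly `β i` on this edge, `d` and `c` agree
    -- at `x`, so `x` is still in `U`.
    with x , x∈Ei , cx≡βi ← c-attains i
    = flip-until-bichromatic d′ d′-attains (U - x) unflipped′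
        (rec (x∈p⇒p-x⊂p (unflipped x (trans (d≡βi x x∈Ei) (sym cx≡βi)))))
    where
    d≡βi : ∀ y → y ∈ E i → d y ≡ β i
    d≡βi y y∈Ei = trans (¬-not (λ dy≡ → mono (y , y∈Ei , dy≡))) (not-involutive (β i))

    d′ : Fin n → Bool
    d′ = updateAt d x not

    d′-attains : ∀ j → Attains d′ (β j) (E j)
    d′-attains j with d-attains j
    ... | y , y∈Ej , dy≡βj with y ≟ᶠ x
    ...   | no y≢x = y , y∈Ej , trans (updateAt-minimal y x d y≢x) dy≡βj
    ...   | yes refl
      -- Edge `j` loses its witness `x`, but `d x` is both `β i` and `β j`, so the two edges share a
      -- class and another vertex `z`. The flip spares `z`, which has colour `β i` like all of edge
      -- `i`. This includes `j = i`.
      with βi≡βj ← trans (sym (d≡βi x x∈Ei)) dy≡βj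
      with z , z∈ , z≢x ← ∣p∣≢1⇒∃-other (x∈p∩q⁺ (x∈Ei , y∈Ej)) (same-class i j βi≡βj)
      with z∈Ei , z∈Ej ← x∈p∩q⁻ (E i) (E j) z∈
      = z , z∈Ej , trans (updateAt-minimal z x d z≢x) (trans (d≡βi z z∈Ei) βi≡βj)

    unflipped′ : ∀ y → d′ y ≡ c y → y ∈ U - x
    unflipped′ y d′y≡cy with y ≟ᶠ x
    ... | no y≢x = x∈p∧x≢y⇒x∈p-y
          (unflipped y (trans (sym (updateAt-minimal y x d y≢x)) d′y≡cy)) y≢x
    ... | yes refl = contradiction
          (trans (sym d′y≡cy) (updateAt-updates x d))
          (not-¬ (trans cx≡βi (sym (d≡βi x x∈Ei))))

  ∃-bichromatic-from-attaining : ∃ λ c′ → ∀ i → Bichromatic c′ (E i)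
  ∃-bichromatic-from-attaining =
    flip-until-bichromatic c c-attains ⊤ (λ _ _ → ∈⊤) (⊂-wellFounded ⊤)

-- By induction the old edges attain both colours, so both `cl` and `not ∘ cl` are possible choices
-- of `β`, and the new edge decides between them.
∃-bichromatic : (E : Fin m → Subset n) (cl : Fin m → Bool) → (∀ i → Nonempty (E i)) →
                (∀ i j → cl i ≡ cl j → ∣ E i ∩ E j ∣ ≢ 1) →
                ∃ λ c → ∀ i → Bichromatic c (E i)
∃-bichromatic {0}  E cl nonempty same-class = (λ _ → true) , λ ()
∃-bichromatic {ℕ.suc _} E cl nonempty same-class
  with c , bi ← ∃-bichromatic (E ∘ suc) (cl ∘ suc) (nonempty ∘ suc)
                  (λ i j → same-class (suc i) (suc j))
  with attains? c (cl zero) (E zero)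
... | yes at = ∃-bichromatic-from-attaining E cl same-class c
      λ { zero → at ; (suc i) → bi i (cl (suc i)) }
-- The new edge is entirely of colour `not (cl zero)`, so the two classes exchange their colours.
... | no ¬at
  with x , x∈E₀ ← nonempty zero
  = ∃-bichromatic-from-attaining E (not ∘ cl) (λ i j → same-class i j ∘ not-injective) c
      λ { zero → x , x∈E₀ , ¬-not (λ cx≡ → ¬at (x , x∈E₀ , cx≡))
        ; (suc i) → bi i (not (cl (suc i))) }

4↔Bool×Bool : Fin 4 ↔ (Bool × Bool)
4↔Bool×Bool = (2↔Bool ×-↔ 2↔Bool) ↔-∘ *↔× {2} {2}

module _ (H : Hypergraph) (h : EdgesOfSize≥2 H)
         {g : Coloring (Hypergraph.size H) 4} (proper : ProperG (H ^[1]) g) where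
  open Hypergraph H
  open Inverse 4↔Bool×Bool using (to; from; strictlyInverseˡ)

  -- The first bit of a colour selects one of the two subhypergraphs, the second a side of its
  -- bipartition.
  half class : Fin size → Bool
  half  = proj₁ ∘ to ∘ g
  class = proj₂ ∘ to ∘ g

  same-color⇒∣∩∣≢1 : ∀ i j → half i ≡ half j → class i ≡ class j → ∣ edge i ∩ edge j ∣ ≢ 1
  same-color⇒∣∩∣≢1 i j half≡ class≡ ∣∩∣≡1 with i ≟ᶠ j
  -- Properness of `g` concerns distinct edges only; here the intersection is the edge itself, of
  -- size at least 2.
  ... | yes refl = <⇒≢ (h i) (sym (trans (cong ∣_∣ (sym (∩-idem (edge i)))) ∣∩∣≡1))
  ... | no i≢j = proper i j (i≢j , ∣∩∣≡1)
        (Injection.injective (Inverse⇒Injection 4↔Bool×Bool) (cong₂ _,_ half≡ class≡))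

  -- The edges of a half are listed, and positions in the list become the `Fin` indices that
  -- `∃-bichromatic` expects.
  half-bichromatic : ∀ a → ∃ λ c → ∀ i → half i ≡ a → Bichromatic c (edge i)
  half-bichromatic a =
    let c , bi = ∃-bichromatic (edge ∘ lookup is) (class ∘ lookup is)
          (λ k → 2≤∣p∣⇒Nonempty _ (h (lookup is k)))
          (λ k l → same-color⇒∣∩∣≢1 _ _ (trans (in-half k) (sym (in-half l))))
    in c , λ i i∈half →
         let i∈is = ∈-filter⁺ (λ i → half i ≟ᵇ a) (∈-allFin i) i∈half
         in subst (Bichromatic c ∘ edge) (sym (lookup-index i∈is)) (bi (index i∈is))
    where
    is = filter (λ i → half i ≟ᵇ a) (allFin size)

    in-half : ∀ k → half (lookup is k) ≡ a
    in-half k = proj₂ (∈-filter⁻ (λ i → half i ≟ᵇ a) {xs = allFin size} (∈-lookup k))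

  colorableH-4 : ColorableH H 4
  colorableH-4 = color , λ i mono → ¬mono i mono (half i) refl
    where
    coloring : Bool → Fin order → Bool
    coloring a = proj₁ (half-bichromatic a)

    color : Coloring order 4
    color x = from (coloring false x , coloring true x)

    color-determines : ∀ a {x y} → color x ≡ color y → coloring a x ≡ coloring a y
    color-determines a {x} {y} eq = component a
      (trans (sym (strictlyInverseˡ _)) (trans (cong to eq) (strictlyInverseˡ _)))
      where
      component : ∀ a → (coloring false x , coloring true x) ≡ (coloring false y , coloring true y) →
                  coloring a x ≡ coloring a y
      component false = cong proj₁
      component true  = cong proj₂

    -- The component of `color` belonging to the edge's own half already takes both values on the
    -- edge.
    ¬mono : ∀ i → Monochromatic color (edge i) → ∀ a → half i ≢ a
    ¬mono i mono a i∈half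
      with x , x∈ , cx≡true  ← proj₂ (half-bichromatic a) i i∈half true
      with y , y∈ , cy≡false ← proj₂ (half-bichromatic a) i i∈half false
      with () ← trans (sym cx≡true) (trans (color-determines a (mono x y x∈ y∈)) cy≡false)

theorem1p4 : (H : Hypergraph) (h : EdgesOfSize≥2 H) → χG (H ^[1]) ≡ 4 → χH H h ≤ 4
theorem1p4 H h χ≡4 =
  let _ , colorable , _ = chromaticNumberG (H ^[1])
      _ , proper = subst (ColorableG (H ^[1])) χ≡4 colorable
  in proj₂ (proj₂ (chromaticNumberH H h)) 4 (colorableH-4 H h proper)
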